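{- Every pattern-free graph class is monadically dependent.
   Context: Graphs are finite, simple and undirected; graph classes are considered up to isomorphism. Write $[n]=\{1,\dots,n\}$. A graph class "contains $H$ as an induced subgraph" if some graph in the class has an induced subgraph isomorphic to $H$. Patterns. For $m,r\in\mathbb{N}$, an $(m,r)$-pattern is a graph $G$ with vertex set $[m]\times[r]$ such that, writing $L_j(G)=\{(i,j):i\in[m]\}$ for the $j$th layer ($j\in[r]$): (1) each layer induces a clique or an independent set; (2) for every two distinct layers $L_j(G),L_{j'}(G)$: if $|j-j'|>1$ they are either fully adjacent or fully non-adjacent, and if $|j-j'|=1$ there is a relation ${\sim}\in\{=,\neq,\le,\ge,<,>\}$ such that for all $i,i'\in[m]$, $(i,j)(i',j')\in E(G)\Leftrightarrow i\sim i'$. A graph is $(m,r)$-pattern-free if it contains no $(m,r)$-pattern as an induced subgraph. A graph class is pattern-free if there are $m,r\in\mathbb{N}$ such that every graph in the class is $(m,r)$-pattern-free. Flips. Let $G$ be a graph, $\mathcal{K}$ a partition of $V(G)$, $\mathcal{K}(v)$ the part containing $v$, and $F\subseteq\mathcal{K}^2$ symmetric. The graph $G\oplus F$ has vertex set $V(G)$ and, for distinct $u,v$: if $(\mathcal{K}(u),\mathcal{K}(v))\in F$ then $uv\in E(G\oplus F)\Leftrightarrow uv\notin E(G)$; otherwise $uv\in E(G\oplus F)\Leftrightarrow uv\in E(G)$. A $k$-flip of $G$ is a graph $G\oplus F$ obtained in this way with $\mathcal{K}$ having at most $k$ parts. Crossings and comparability grids. For $r\ge1$, the star $r$-crossing of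 order $n$ is the $r$-subdivision of $K_{n,n}$: it has roots $a_1,\dots,a_n$, $b_1,\dots,b_n$ and pairwise vertex-disjoint $r$-vertex paths $\pi_{i,j}$ ($i,j\in[n]$) not containing roots, with $\pi(i,j,t)$ denoting the $t$th vertex of $\pi_{i,j}$; each $a_i$ is adjacent to $\{\pi(i,j,1):j\in[n]\}$ and each $b_j$ is adjacent to $\{\pi(i,j,r):i\in[n]\}$. The clique $r$-crossing of order $n$ is obtained from the star $r$-crossing of order $n$ by turning the neighborhood of each root into a clique. The half-graph $r$-crossing of order $n$ is defined like the star $r$-crossing, except that each root $a_i$ is instead adjacent to $\{\pi(i',j,1):i',j\in[n],\,i\le i'\}$ and each root $b_j$ is instead adjacent to $\{\pi(i,j',r):i,j'\in[n],\,j\le j'\}$. There are no edges other than those described. The comparability grid of order $n$ has vertices $a_{i,j}$ ($i,j\in[n]$), with distinct $a_{i,j},a_{i',j'}$ adjacent if and only if $i=i'$, or $j=j'$, or ($i<i'\Leftrightarrow j<j'$). Monadic dependence. A graph class $\mathscr{C}$ is monadically independent if there are $r\ge1$ and $k\in\mathbb{N}$ such that at least one of the following holds: for every $n$, $\mathscr{C}$ contains a $k$-flip of the star $r$-crossing of order $n$ as an induced subgraph; for every $n$, $\mathscr{C}$ contains a $k$-flip of the clique $r$-crossing of order $n$ as an induced subgraph; for every $n$, $\mathscr{C}$ contains a $k$-flip of the half-graph $r$-crossing of order $n$ as an induced subgraph; for every $n$, $\mathscr{C}$ contains the comparability grid of order $n$ as an induced subgraph. Otherwise $\mathscr{C}$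 is monadically dependent. (This is known to be equivalent to the model-theoretic definition via first-order transductions.) -}

module Defs where

open import Data.Fin.Base using (Fin; toℕ; _≤_; _<_; _≥_; _>_)
open import Data.Fin.Properties using (_≟_; _≤?_; _<?_; any?; <-cmp)
open import Data.Nat.Base as ℕ using (ℕ; suc; ∣_-_∣)
import Data.Nat.Properties as ℕ
open import Data.Product.Base using (∃-syntax; Σ-syntax; _×_; _,_)
open import Data.Product.Properties using (≡-dec)
open import Data.Sum.Base using (_⊎_; inj₁; inj₂; [_,_])
open import Function.Bundles using (_⇔_; mk⇔; module Equivalence)
open import Function.Definitions using (Injective)
open import Level using (Level; 0ℓ)
  renaming (suc to lsuc; _⊔_ to _⊔ˡ_)
open import Relation.Binary.Core using (Rel)
open import Relation.Binary.Definitions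
  using (Symmetric; Irreflexive; Decidable; DecidableEquality; tri<; tri≈; tri>)
open import Relation.Binary.Construct.Closure.Symmetric as SymClosure
  using (SymClosure; fwd; bwd)
open import Relation.Binary.PropositionalEquality
  using (_≡_; _≢_; refl; sym; cong)
open import Relation.Nullary using (¬_; no; contradiction)
open import Relation.Nullary.Decidable using (map′; ¬?; _×-dec_; _⊎-dec_; _→-dec_)
open import Relation.Unary using (Pred; _∈_)

private
  variable
    ℓ : Level
    V W : Set

------------------------------------------------------------------------
-- Graphs and graph classes

record SimpleGraph (V : Set) : Set₁ where
  field
    Adj        : Rel V 0ℓ
    adj?       : Decidable Adj
    adj-sym    : Symmetric Adj
    adj-irrefl : Irreflexive _≡_ Adj

open SimpleGraph public

-- Up to isomorphism, a finite graph has vertex set Fin order.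
record FiniteGraph : Set₁ where
  constructor finiteGraph
  field
    order : ℕ
    graph : SimpleGraph (Fin order)

open FiniteGraph public

-- A class may hold any representatives of the isomorphism types it
-- consists of: membership is only ever tested through _⊑_ below, which is
-- invariant under isomorphism.
GraphClass : (ℓ : Level) → Set (lsuc ℓ ⊔ˡ lsuc 0ℓ)
GraphClass ℓ = Pred FiniteGraph ℓ

-- H ⊑ G: some induced subgraph of G (the one on the image of embed) is
-- isomorphic to H.
record _⊑_ (H : SimpleGraph V) (G : SimpleGraph W) : Set where
  field
    embed     : V → W
    injective : Injective _≡_ _≡_ embed
    adj⇔      : ∀ u v → Adj H u v ⇔ Adj G (embed u) (embed v)

infix 4 _⊑_

Contains : GraphClass ℓ → SimpleGraph V → Set (lsuc 0ℓ ⊔ˡ ℓ)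
Contains 𝒞 H = Σ[ G ∈ FiniteGraph ] (G ∈ 𝒞 × H ⊑ graph G)

------------------------------------------------------------------------
-- Patterns

data Comparison : Set where
  eq neq le ge lt gt : Comparison

⟦_⟧ : Comparison → ∀ {m} → Rel (Fin m) 0ℓ
⟦ eq  ⟧ = _≡_
⟦ neq ⟧ = _≢_
⟦ le  ⟧ = _≤_
⟦ ge  ⟧ = _≥_
⟦ lt  ⟧ = _<_
⟦ gt  ⟧ = _>_

-- The vertex (i , j) is the ith vertex of the jth layer.
record IsPattern (m r : ℕ) (G : SimpleGraph (Fin m × Fin r)) : Set where
  field
    layer    : ∀ j → (∀ i i′ → i ≢ i′ → Adj G (i , j) (i′ , j))
                   ⊎ (∀ i i′ → ¬ Adj G (i , j) (i′ , j))
    distant  : ∀ j j′ → 1 ℕ.< ∣ toℕ j - toℕ j′ ∣ →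
               (∀ i i′ → Adj G (i , j) (i′ , j′))
             ⊎ (∀ i i′ → ¬ Adj G (i , j) (i′ , j′))
    adjacent : ∀ j j′ → ∣ toℕ j - toℕ j′ ∣ ≡ 1 →
               ∃[ ∼ ] (∀ i i′ → Adj G (i , j) (i′ , j′) ⇔ ⟦ ∼ ⟧ i i′)

IsPatternFree : (m r : ℕ) → SimpleGraph V → Set₁
IsPatternFree m r G = ∀ P → IsPattern m r P → ¬ (P ⊑ G)

PatternFree : GraphClass ℓ → Set (lsuc 0ℓ ⊔ˡ ℓ)
PatternFree 𝒞 = ∃[ m ] ∃[ r ] (∀ G → G ∈ 𝒞 → IsPatternFree m r (graph G))

------------------------------------------------------------------------
-- Flips

-- A partition into at most k parts is given by the function sending each
-- vertex to the index of its part; indices that are not attained stand for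
-- no part.
record IsFlip (k : ℕ) (G H : SimpleGraph V) : Set₁ where
  field
    part      : V → Fin k
    F         : Rel (Fin k) 0ℓ
    F?        : Decidable F
    F-sym     : Symmetric F
    flipped   : ∀ u v → u ≢ v → F (part u) (part v) →
                Adj H u v ⇔ (¬ Adj G u v)
    unflipped : ∀ u v → u ≢ v → ¬ F (part u) (part v) →
                Adj H u v ⇔ Adj G u v

ContainsFlip : GraphClass ℓ → ℕ → SimpleGraph V → Set (lsuc 0ℓ ⊔ˡ ℓ)
ContainsFlip 𝒞 k G = ∃[ H ] (IsFlip k G H × Contains 𝒞 H)

------------------------------------------------------------------------
-- Crossings

data CrossingVertex (n r : ℕ) : Set where
  a b : Fin n → CrossingVertex n r
  π   : (i j : Fin n) (t : Fin r) → CrossingVertex n r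

infix 4 _≟ᶜ_

_≟ᶜ_ : ∀ {n r} → DecidableEquality (CrossingVertex n r)
a i ≟ᶜ a i′ = map′ (cong a) (λ { refl → refl }) (i ≟ i′)
b j ≟ᶜ b j′ = map′ (cong b) (λ { refl → refl }) (j ≟ j′)
π i j t ≟ᶜ π i′ j′ t′ =
  map′ (λ { (refl , refl , refl) → refl }) (λ { refl → refl , refl , refl })
       (i ≟ i′ ×-dec j ≟ j′ ×-dec t ≟ t′)
a _ ≟ᶜ b _ = no λ ()
a _ ≟ᶜ π _ _ _ = no λ ()
b _ ≟ᶜ a _ = no λ ()
b _ ≟ᶜ π _ _ _ = no λ ()
π _ _ _ ≟ᶜ a _ = no λ ()
π _ _ _ ≟ᶜ b _ = no λ ()

-- Each edge of a crossing, in one orientation. The relation ∼ tells which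
-- paths a root is attached to: ≡ for star crossings, ≤ for half-graph
-- crossings. Path positions t are counted from 0 to r - 1.
data Arc {n r : ℕ} (_∼_ : Rel (Fin n) 0ℓ) : Rel (CrossingVertex n r) 0ℓ where
  rootᵃ : ∀ {i i′ j t} → i ∼ i′ → toℕ t ≡ 0 → Arc _∼_ (a i) (π i′ j t)
  rootᵇ : ∀ {j i j′ t} → j ∼ j′ → suc (toℕ t) ≡ r → Arc _∼_ (b j) (π i j′ t)
  path  : ∀ {i j t t′} → suc (toℕ t) ≡ toℕ t′ → Arc _∼_ (π i j t) (π i j t′)

module _ {n r : ℕ} {_∼_ : Rel (Fin n) 0ℓ} (_∼?_ : Decidable _∼_) where

  arc? : Decidable (Arc {n} {r} _∼_)
  arc? (a i) (π i′ j t) =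
    map′ (λ (p , q) → rootᵃ p q) (λ { (rootᵃ p q) → p , q })
         ((i ∼? i′) ×-dec (toℕ t ℕ.≟ 0))
  arc? (b j) (π i j′ t) =
    map′ (λ (p , q) → rootᵇ p q) (λ { (rootᵇ p q) → p , q })
         ((j ∼? j′) ×-dec (suc (toℕ t) ℕ.≟ r))
  arc? (π i j t) (π i′ j′ t′) =
    map′ (λ { (refl , refl , p) → path p }) (λ { (path p) → refl , refl , p })
         (i ≟ i′ ×-dec j ≟ j′ ×-dec (suc (toℕ t) ℕ.≟ toℕ t′))
  arc? (a _) (a _) = no λ ()
  arc? (a _) (b _) = no λ ()
  arc? (b _) (a _) = no λ ()
  arc? (b _) (b _) = no λ ()
  arc? (π _ _ _) (a _) = no λ ()
  arc? (π _ _ _) (b _) = no λ ()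

  arc-irrefl : ∀ {u} → ¬ Arc {n} {r} _∼_ u u
  arc-irrefl (path p) = ℕ.1+n≢n p

  crossing : SimpleGraph (CrossingVertex n r)
  crossing .Adj = SymClosure (Arc _∼_)
  crossing .adj? u v =
    map′ [ fwd , bwd ] (λ { (fwd e) → inj₁ e ; (bwd e) → inj₂ e })
         (arc? u v ⊎-dec arc? v u)
  crossing .adj-sym = SymClosure.symmetric (Arc _∼_)
  crossing .adj-irrefl refl (fwd e) = arc-irrefl e
  crossing .adj-irrefl refl (bwd e) = arc-irrefl e

starCrossing : (r n : ℕ) → SimpleGraph (CrossingVertex n r)
starCrossing r n = crossing _≟_

halfGraphCrossing : (r n : ℕ) → SimpleGraph (CrossingVertex n r)
halfGraphCrossing r n = crossing _≤?_

CommonRoot : (r n : ℕ) → Rel (CrossingVertex n r) 0ℓ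
CommonRoot r n u v =
    (∃[ i ] (Adj S (a i) u × Adj S (a i) v))
  ⊎ (∃[ j ] (Adj S (b j) u × Adj S (b j) v))
  where S = starCrossing r n

cliqueCrossing : (r n : ℕ) → SimpleGraph (CrossingVertex n r)
cliqueCrossing r n = record
  { Adj  = λ u v → Adj S u v ⊎ (u ≢ v × CommonRoot r n u v)
  ; adj? = λ u v → adj? S u v ⊎-dec (¬? (u ≟ᶜ v) ×-dec
      (any? (λ i → adj? S (a i) u ×-dec adj? S (a i) v)
        ⊎-dec any? (λ j → adj? S (b j) u ×-dec adj? S (b j) v)))
  ; adj-sym = λ
      { (inj₁ e) → inj₁ (adj-sym S e)
      ; (inj₂ (u≢v , inj₁ (i , p , q))) →
          inj₂ ((λ v≡u → u≢v (sym v≡u)) , inj₁ (i , q , p))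
      ; (inj₂ (u≢v , inj₂ (j , p , q))) →
          inj₂ ((λ v≡u → u≢v (sym v≡u)) , inj₂ (j , q , p)) }
  ; adj-irrefl = λ
      { u≡v (inj₁ e) → adj-irrefl S u≡v e
      ; u≡v (inj₂ (u≢v , _)) → u≢v u≡v }
  }
  where S = starCrossing r n

------------------------------------------------------------------------
-- Comparability grids

GridAdj : (n : ℕ) → Rel (Fin n × Fin n) 0ℓ
GridAdj n (i , j) (i′ , j′) =
  (i , j) ≢ (i′ , j′) × (i ≡ i′ ⊎ j ≡ j′ ⊎ (i < i′ ⇔ j < j′))

gridAdj-sym : ∀ {n} → Symmetric (GridAdj n)
gridAdj-sym {n} {i , j} {i′ , j′} (u≢v , e) = (λ v≡u → u≢v (sym v≡u)) , swap e
  where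
  swap : i ≡ i′ ⊎ j ≡ j′ ⊎ (i < i′ ⇔ j < j′) →
         i′ ≡ i ⊎ j′ ≡ j ⊎ (i′ < i ⇔ j′ < j)
  swap (inj₁ p) = inj₁ (sym p)
  swap (inj₂ (inj₁ p)) = inj₂ (inj₁ (sym p))
  swap (inj₂ (inj₂ f)) with <-cmp i i′ | <-cmp j j′
  ... | tri≈ _ p _ | _ = inj₁ (sym p)
  ... | tri< _ _ _ | tri≈ _ p _ = inj₂ (inj₁ (sym p))
  ... | tri> _ _ _ | tri≈ _ p _ = inj₂ (inj₁ (sym p))
  ... | tri< _ _ ≯i | tri< _ _ ≯j =
    inj₂ (inj₂ (mk⇔ (λ p → contradiction p ≯i) (λ p → contradiction p ≯j)))
  ... | tri< <i _ _ | tri> ≮j _ _ = contradiction (Equivalence.to f <i) ≮j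
  ... | tri> ≮i _ _ | tri< <j _ _ = contradiction (Equivalence.from f <j) ≮i
  ... | tri> _ _ >i | tri> _ _ >j = inj₂ (inj₂ (mk⇔ (λ _ → >j) (λ _ → >i)))

comparabilityGrid : (n : ℕ) → SimpleGraph (Fin n × Fin n)
comparabilityGrid n = record
  { Adj  = GridAdj n
  ; adj? = λ (i , j) (i′ , j′) →
      ¬? (≡-dec _≟_ _≟_ (i , j) (i′ , j′)) ×-dec
      (i ≟ i′ ⊎-dec j ≟ j′ ⊎-dec
        map′ (λ (f , g) → mk⇔ f g) (λ f → Equivalence.to f , Equivalence.from f)
             ((i <? i′ →-dec j <? j′) ×-dec (j <? j′ →-dec i <? i′)))
  ; adj-sym = gridAdj-sym
  ; adj-irrefl = λ u≡v (u≢v , _) → u≢v u≡v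
  }

------------------------------------------------------------------------
-- Monadic dependence

MonadicallyIndependent : GraphClass ℓ → Set (lsuc 0ℓ ⊔ˡ ℓ)
MonadicallyIndependent 𝒞 = ∃[ r ] ∃[ k ] (1 ℕ.≤ r ×
  ( (∀ n → ContainsFlip 𝒞 k (starCrossing r n))
  ⊎ (∀ n → ContainsFlip 𝒞 k (cliqueCrossing r n))
  ⊎ (∀ n → ContainsFlip 𝒞 k (halfGraphCrossing r n))
  ⊎ (∀ n → Contains 𝒞 (comparabilityGrid n))))

MonadicallyDependent : GraphClass ℓ → Set (lsuc 0ℓ ⊔ˡ ℓ)
MonadicallyDependent 𝒞 = ¬ MonadicallyIndependent 𝒞

{-# OPTIONS --safe #-}

-- If a class contains k-flips of all star (clique, half-graph) r-crossings, the pigeonhole principle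
-- provides a large subcrossing in which the part of a vertex depends only on its type: root a,
-- root b, or position on its path. The flip is then constant between any two types, so it preserves
-- patterns whose layers consist of vertices of one type. Such a pattern comes from a walk along the
-- paths π(0,0), π(1,0), π(1,1), π(2,1), …, alternately upwards and downwards, blown up by replacing
-- every index with a block of m consecutive indices and taking the diagonal of each block. The walk
-- visits the roots it passes in star and half-graph crossings, but skips them in clique crossings,
-- where the paths before and after a root are already adjacent. In a comparability grid the diagonals
-- of the same staircase of m × m cells form a pattern.
module Submission where

open import Defs
open import Data.Fin.Base as Fin
  using (Fin; zero; suc; toℕ; fromℕ<; inject₁; inject≤; combine; remQuot; opposite; punchOut;
         _↑ˡ_; _↑ʳ_)
import Data.Fin.Properties as Fin
open import Data.Nat.Base as ℕ using (ℕ; zero; suc; _+_; _*_; _∸_; z≤n; s≤s; ∣_-_∣; ⌊_/2⌋; ⌈_/2⌉)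
import Data.Nat.Properties as ℕ
open import Data.Product.Base using (∃-syntax; Σ-syntax; _×_; _,_; proj₁; proj₂)
open import Data.Sum.Base as Sum using (_⊎_; inj₁; inj₂; [_,_])
open import Function.Base using (_∘_; id)
open import Function.Bundles using (_⇔_; mk⇔; module Equivalence)
open import Function.Construct.Composition using (_⇔-∘_)
open import Function.Construct.Symmetry using (⇔-sym)
open import Function.Definitions using (Injective)
open import Function.Related.TypeIsomorphisms using (¬-cong-⇔)
open import Level using (Level; 0ℓ)
open import Relation.Binary.Construct.Closure.Symmetric using (SymClosure; fwd; bwd)
open import Relation.Binary.Core using (Rel; REL; _Preserves_⟶_)
import Relation.Binary.Definitions as Binary
open import Relation.Binary.Definitions using (tri<; tri≈; tri>)
open import Relation.Binary.PropositionalEquality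
  using (_≡_; _≢_; refl; sym; trans; cong; cong₂; subst; subst₂; ≢-sym; module ≡-Reasoning)
open import Relation.Nullary using (¬_; yes; no; contradiction)
open import Relation.Nullary.Decidable using (decidable-stable)
open import Relation.Unary using (Pred; Decidable)

open Equivalence using (to; from)

private
  variable
    V W : Set
    k m n r w N Q R : ℕ

-- Induced subgraphs and comparisons

comap : (V → W) → SimpleGraph W → SimpleGraph V
comap e G = record
  { Adj        = λ u v → Adj G (e u) (e v)
  ; adj?       = λ u v → adj? G (e u) (e v)
  ; adj-sym    = adj-sym G
  ; adj-irrefl = λ u≡v → adj-irrefl G (cong e u≡v)
  }

adj-comm : (G : SimpleGraph V) → ∀ {u v} → Adj G u v ⇔ Adj G v u
adj-comm G = mk⇔ (adj-sym G) (adj-sym G)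

comap-⊑ : {G : SimpleGraph W} {e : V → W} → Injective _≡_ _≡_ e → comap e G ⊑ G
comap-⊑ {e = e} e-inj = record
  { embed = e ; injective = e-inj ; adj⇔ = λ _ _ → mk⇔ id id }

⊑-trans : {U : Set} {F : SimpleGraph U} {G : SimpleGraph V} {H : SimpleGraph W} →
          F ⊑ G → G ⊑ H → F ⊑ H
⊑-trans p q = record
  { embed     = q.embed ∘ p.embed
  ; injective = p.injective ∘ q.injective
  ; adj⇔      = λ u v → q.adj⇔ (p.embed u) (p.embed v) ⇔-∘ p.adj⇔ u v
  }
  where
  module p = _⊑_ p
  module q = _⊑_ q

converse : Comparison → Comparison
converse eq  = eq
converse neq = neq
converse le  = ge
converse ge  = le
converse lt  = gt
converse gt  = lt

converse-⇔ : ∀ c {i i′ : Fin m} → ⟦ c ⟧ i i′ ⇔ ⟦ converse c ⟧ i′ i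
converse-⇔ eq  = mk⇔ sym sym
converse-⇔ neq = mk⇔ ≢-sym ≢-sym
converse-⇔ le  = mk⇔ id id
converse-⇔ ge  = mk⇔ id id
converse-⇔ lt  = mk⇔ id id
converse-⇔ gt  = mk⇔ id id

complement : Comparison → Comparison
complement eq  = neq
complement neq = eq
complement le  = gt
complement ge  = lt
complement lt  = ge
complement gt  = le

-- Closure of the six comparisons under negation is what lets a flip between consecutive layers
-- produce a pattern again.
complement-⇔ : ∀ c {i i′ : Fin m} → (¬ ⟦ c ⟧ i i′) ⇔ ⟦ complement c ⟧ i i′
complement-⇔ eq  = mk⇔ id id
complement-⇔ neq = mk⇔ (decidable-stable (_ Fin.≟ _)) contradiction
complement-⇔ le  = mk⇔ ℕ.≰⇒> ℕ.<⇒≱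
complement-⇔ ge  = mk⇔ ℕ.≰⇒> ℕ.<⇒≱
complement-⇔ lt  = mk⇔ ℕ.≮⇒≥ ℕ.≤⇒≯
complement-⇔ gt  = mk⇔ ℕ.≮⇒≥ ℕ.≤⇒≯

-- Patterns

HasPattern : ℕ → ℕ → SimpleGraph V → Set₁
HasPattern m R G = ∃[ P ] (IsPattern m R P × P ⊑ G)

Homogeneous : {A B : Set} → REL A B 0ℓ → Set
Homogeneous R = (∀ x y → R x y) ⊎ (∀ x y → ¬ R x y)

Compared : Rel (Fin m) 0ℓ → Set
Compared R = ∃[ ∼ ] (∀ i i′ → R i i′ ⇔ ⟦ ∼ ⟧ i i′)

flip-homogeneous : (G : SimpleGraph W) {A B : Set} (e : A → W) (f : B → W) →
                   Homogeneous (λ x y → Adj G (e x) (f y)) →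
                   Homogeneous (λ y x → Adj G (f y) (e x))
flip-homogeneous G e f = Sum.map (λ full y x → adj-sym G (full x y))
                                 (λ none y x → none x y ∘ adj-sym G)

flip-compared : (G : SimpleGraph W) (e f : Fin m → W) →
                Compared (λ i i′ → Adj G (e i) (f i′)) →
                Compared (λ i i′ → Adj G (f i) (e i′))
flip-compared G e f (c , p) =
  converse c , λ i i′ → converse-⇔ c ⇔-∘ (p i′ i ⇔-∘ adj-comm G)

1<∣-∣ : ∀ x y → 1 ℕ.< ∣ x - y ∣ → suc x ℕ.< y ⊎ suc y ℕ.< x
1<∣-∣ zero    y       p = inj₁ p
1<∣-∣ (suc x) zero    p = inj₂ p
1<∣-∣ (suc x) (suc y) p = Sum.map s≤s s≤s (1<∣-∣ x y p)

∣-∣≡1 : ∀ x y → ∣ x - y ∣ ≡ 1 → suc x ≡ y ⊎ suc y ≡ x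
∣-∣≡1 zero    y       p = inj₁ (sym p)
∣-∣≡1 (suc x) zero    p = inj₂ (sym p)
∣-∣≡1 (suc x) (suc y) p = Sum.map (cong suc) (cong suc) (∣-∣≡1 x y p)

module _ (G : SimpleGraph V) (e : Fin R → Fin m → V) where

  Between : Fin R → Fin R → Rel (Fin m) 0ℓ
  Between j j′ i i′ = Adj G (e j i) (e j′ i′)

  -- Adjacency is symmetric, so pairs with `j` before `j′` suffice; the opposite order is covered by
  -- the converse comparison.
  layers-pattern :
    (∀ j → (∀ i i′ → i ≢ i′ → Between j j i i′) ⊎ (∀ i i′ → ¬ Between j j i i′)) →
    (∀ j j′ → suc (toℕ j) ℕ.< toℕ j′ → Homogeneous (Between j j′)) →
    (∀ j j′ → suc (toℕ j) ≡ toℕ j′ → Compared (Between j j′)) →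
    IsPattern m R (comap (λ (i , j) → e j i) G)
  layers-pattern same far near = record
    { layer    = same
    ; distant  = λ j j′ → [ far j j′ , flip-homogeneous G (e j′) (e j) ∘ far j′ j ]
                        ∘ 1<∣-∣ (toℕ j) (toℕ j′)
    ; adjacent = λ j j′ → [ near j j′ , flip-compared G (e j′) (e j) ∘ near j′ j ]
                        ∘ ∣-∣≡1 (toℕ j) (toℕ j′)
    }

-- Flips

module _ {G H : SimpleGraph V} (flipped : IsFlip k G H)
         (e : Fin m × Fin R → V) (e-inj : Injective _≡_ _≡_ e)
         (colour : Fin R → Fin k)
         (coloured : ∀ i j → IsFlip.part flipped (e (i , j)) ≡ colour j)
         where

  private
    module H = IsFlip flipped

    e-≢ : ∀ {x y} → x ≢ y → e x ≢ e y
    e-≢ x≢y = x≢y ∘ e-inj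

  -- The part of a vertex depends only on its layer, so `F` decides once for each pair of layers
  -- whether adjacency is kept or negated. Distinctness is a premise because a flip says nothing
  -- about a vertex paired with itself.
  flip-between : ∀ j j′ →
      (∀ i i′ → (i , j) ≢ (i′ , j′) →
        Adj H (e (i , j)) (e (i′ , j′)) ⇔ Adj G (e (i , j)) (e (i′ , j′)))
    ⊎ (∀ i i′ → (i , j) ≢ (i′ , j′) →
        Adj H (e (i , j)) (e (i′ , j′)) ⇔ (¬ Adj G (e (i , j)) (e (i′ , j′))))
  flip-between j j′ with H.F? (colour j) (colour j′)
  ... | yes F = inj₂ λ i i′ ≢ → H.flipped _ _ (e-≢ ≢)
          (subst₂ H.F (sym (coloured i j)) (sym (coloured i′ j′)) F)
  ... | no ¬F = inj₁ λ i i′ ≢ → H.unflipped _ _ (e-≢ ≢)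
          (¬F ∘ subst₂ H.F (coloured i j) (coloured i′ j′))

  -- Negation exchanges cliques with independent sets and full with empty adjacency, and turns a
  -- comparison into its complement.
  flip-pattern : IsPattern m R (comap e G) → IsPattern m R (comap e H)
  flip-pattern P = record { layer = layer′ ; distant = distant′ ; adjacent = adjacent′ }
    where
    open IsPattern P
    layer′ : ∀ j → _
    layer′ j with flip-between j j | layer j
    ... | inj₁ f | inj₁ p = inj₁ λ i i′ ≢ → from (f i i′ (≢ ∘ cong proj₁)) (p i i′ ≢)
    -- The edge `q` itself forces `i` and `i′` to differ, by irreflexivity of `H`.
    ... | inj₁ f | inj₂ p = inj₂ λ i i′ q → p i i′ (to (f i i′ λ { refl → adj-irrefl H refl q }) q)
    ... | inj₂ f | inj₁ p = inj₂ λ i i′ q →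
                              let i≢i′ = λ { refl → adj-irrefl H refl q }
                              in to (f i i′ (i≢i′ ∘ cong proj₁)) q (p i i′ i≢i′)
    ... | inj₂ f | inj₂ p = inj₁ λ i i′ ≢ → from (f i i′ (≢ ∘ cong proj₁)) (p i i′)

    distant′ : ∀ j j′ → 1 ℕ.< ∣ toℕ j - toℕ j′ ∣ → _
    distant′ j j′ d = combined (flip-between j j′) (distant j j′ d)
      where
      ≢ : ∀ {i i′} → (i , j) ≢ (i′ , j′)
      ≢ refl = contradiction (subst (1 ℕ.<_) (ℕ.∣n-n∣≡0 (toℕ j)) d) λ ()

      combined : _ → _ → Homogeneous (λ i i′ → Adj H (e (i , j)) (e (i′ , j′)))
      combined (inj₁ f) (inj₁ p) = inj₁ λ i i′ → from (f i i′ ≢) (p i i′)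
      combined (inj₁ f) (inj₂ p) = inj₂ λ i i′ → p i i′ ∘ to (f i i′ ≢)
      combined (inj₂ f) (inj₁ p) = inj₂ λ i i′ q → to (f i i′ ≢) q (p i i′)
      combined (inj₂ f) (inj₂ p) = inj₁ λ i i′ → from (f i i′ ≢) (p i i′)

    adjacent′ : ∀ j j′ → ∣ toℕ j - toℕ j′ ∣ ≡ 1 → _
    adjacent′ j j′ d = combined (flip-between j j′) (adjacent j j′ d)
      where
      ≢ : ∀ {i i′} → (i , j) ≢ (i′ , j′)
      ≢ refl = contradiction (trans (sym (ℕ.∣n-n∣≡0 (toℕ j))) d) λ ()

      combined : _ → _ → Compared (λ i i′ → Adj H (e (i , j)) (e (i′ , j′)))
      combined (inj₁ f) (c , p) = c , λ i i′ → p i i′ ⇔-∘ f i i′ ≢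
      combined (inj₂ f) (c , p) = complement c , λ i i′ →
        complement-⇔ c ⇔-∘ (¬-cong-⇔ (p i i′) ⇔-∘ f i i′ ≢)

-- A pigeonhole principle for grids

StrictlyMonotone : (Fin m → Fin n) → Set
StrictlyMonotone f = f Preserves Fin._<_ ⟶ Fin._<_

prepend : (Fin m → Fin n) → Fin (suc m) → Fin (suc n)
prepend f zero    = zero
prepend f (suc i) = suc (f i)

prepend-mono : {f : Fin m → Fin n} → StrictlyMonotone f → StrictlyMonotone (prepend f)
prepend-mono f-mono {zero}  {suc j} _         = s≤s z≤n
prepend-mono f-mono {suc i} {suc j} (s≤s i<j) = s≤s (f-mono i<j)

-- Selections are increasing rather than merely injective, because half-graph crossings depend on
-- the order of the indices.
Selection : ℕ → Pred (Fin n) 0ℓ → Set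
Selection {n} N P = Σ[ f ∈ (Fin N → Fin n) ] (StrictlyMonotone f × (∀ i → P (f i)))

skip : {P : Pred (Fin (suc n)) 0ℓ} → Selection N (P ∘ suc) → Selection N P
skip (f , f-mono , p) = suc ∘ f , (λ i<j → s≤s (f-mono i<j)) , p

take : {P : Pred (Fin (suc n)) 0ℓ} → P zero → Selection N (P ∘ suc) → Selection (suc N) P
take p₀ (f , f-mono , p) = prepend f , prepend-mono f-mono , λ { zero → p₀ ; (suc i) → p i }

-- Each index in turn lowers the target of its own colour by one, and the target that reaches zero
-- first is met.
two-colours : ∀ x y → x + y ℕ.≤ n → {P : Pred (Fin n) 0ℓ} → Decidable P →
              Selection x P ⊎ Selection y (λ i → ¬ P i)
two-colours zero    y       _  P? = inj₁ ((λ ()) , (λ { {()} }) , λ ())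
two-colours (suc x) zero    _  P? = inj₂ ((λ ()) , (λ { {()} }) , λ ())
two-colours {suc n} (suc x) (suc y) (s≤s x+y≤n) {P} P? with P? zero
... | yes p = Sum.map (take {P = P} p) (skip {P = λ i → ¬ P i})
                (two-colours x (suc y) x+y≤n (P? ∘ suc))
... | no ¬p = Sum.map (skip {P = P}) (take {P = λ i → ¬ P i} ¬p)
                (two-colours (suc x) y (subst (ℕ._≤ n) (ℕ.+-suc x y) x+y≤n) (P? ∘ suc))

-- Induction on the number of colours: either colour `zero` occurs `N` times, or enough indices
-- avoid it to apply the case of one colour less.
pigeonhole : ∀ k N → ∃[ n ] ∀ (c : Fin n → Fin k) → ∃[ v ] Selection N (λ i → c i ≡ v)
pigeonhole zero    N = 1 , λ c → contradiction (c zero) λ ()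
pigeonhole (suc k) N with n , select ← pigeonhole k N = N + n , λ c → pick c
  where
  pick : (c : Fin (N + n) → Fin (suc k)) → ∃[ v ] Selection N (λ i → c i ≡ v)
  pick c with two-colours N n ℕ.≤-refl (λ i → c i Fin.≟ zero)
  ... | inj₁ s = zero , s
  ... | inj₂ (f , f-mono , c≢0)
        -- `punchOut` renumbers the colours other than `zero`; the answer `suc v` undoes this.
        with v , g , g-mono , p ← select (λ i → punchOut (≢-sym (c≢0 i)))
        = suc v , f ∘ g , (λ i<j → f-mono (g-mono i<j)) ,
          λ i → trans (sym (Fin.punchIn-punchOut (≢-sym (c≢0 (g i))))) (cong suc (p i))

-- The colourings are made constant one after another, each inside the indices selected for the
-- previous ones.
simultaneous-pigeonhole : ∀ k M N → ∃[ n ] ∀ (c : Fin M → Fin n → Fin k) →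
  Σ[ v ∈ (Fin M → Fin k) ] Selection N (λ i → ∀ x → c x i ≡ v x)
simultaneous-pigeonhole k zero    N = N , λ c → (λ ()) , id , id , λ _ ()
simultaneous-pigeonhole k (suc M) N
  with n′ , rest  ← simultaneous-pigeonhole k M N
  with n  , first ← pigeonhole k n′
  = n , λ c →
    let v₀ , f , f-mono , p = first (c zero)
        v  , g , g-mono , q = rest (λ x i → c (suc x) (f i))
    in prepend-value v₀ v , f ∘ g , (λ i<j → f-mono (g-mono i<j)) , λ where
         i zero    → p (g i)
         i (suc x) → q i x
  where
  prepend-value : Fin k → (Fin M → Fin k) → Fin (suc M) → Fin k
  prepend-value v₀ v zero    = v₀
  prepend-value v₀ v (suc x) = v x

record HomogeneousSubcrossing N (part : CrossingVertex n r → Fin k) : Set where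
  field
    row col           : Fin N → Fin n
    row-mono          : StrictlyMonotone row
    col-mono          : StrictlyMonotone col
    colourᵃ colourᵇ   : Fin k
    colourᵖ           : Fin r → Fin k
    colouredᵃ         : ∀ i → part (a (row i)) ≡ colourᵃ
    colouredᵇ         : ∀ j → part (b (col j)) ≡ colourᵇ
    colouredᵖ         : ∀ i j t → part (π (row i) (col j) t) ≡ colourᵖ t

-- The colours that a row meets on M columns form one of boundedly many vectors; on rows with a
-- common vector the colour of a path depends only on its column.
homogeneous-subcrossing : ∀ k r N → ∃[ n ] ∀ (part : CrossingVertex n r → Fin k) →
                          HomogeneousSubcrossing N part
homogeneous-subcrossing k r N
  with M  , cols ← simultaneous-pigeonhole k (suc r) N
  -- A row carries the colour of its root and of its `r` path vertices in each of `M` columns.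
  with n′ , rows ← simultaneous-pigeonhole k (suc (M * r)) N
  -- Rows are chosen among the first `n′` indices and columns among the last `M`, so one order
  -- serves both.
  = n′ + M , select
  where
  select : (part : CrossingVertex (n′ + M) r → Fin k) → HomogeneousSubcrossing N part
  select part = record
    { row       = (_↑ˡ M) ∘ f
    ; col       = (n′ ↑ʳ_) ∘ g
    ; row-mono  = λ i<j → subst₂ ℕ._<_ (sym (Fin.toℕ-↑ˡ _ M)) (sym (Fin.toℕ-↑ˡ _ M)) (f-mono i<j)
    ; col-mono  = λ i<j → subst₂ ℕ._<_ (sym (Fin.toℕ-↑ʳ n′ _)) (sym (Fin.toℕ-↑ʳ n′ _))
                            (ℕ.+-monoʳ-< n′ (g-mono i<j))
    ; colourᵃ   = v zero
    ; colourᵇ   = v′ zero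
    ; colourᵖ   = v′ ∘ suc
    ; colouredᵃ = λ i → p i zero
    ; colouredᵇ = λ j → q j zero
    ; colouredᵖ = λ i j t → trans
        (trans (cong (λ x → part (π (f i ↑ˡ M) (n′ ↑ʳ proj₁ x) (proj₂ x)))
                     (sym (Fin.remQuot-combine (g j) t)))
               (p i (suc (combine (g j) t))))
        (q j (suc t))
    }
    where
    rowColour : Fin (suc (M * r)) → Fin n′ → Fin k
    rowColour zero    i = part (a (i ↑ˡ M))
    rowColour (suc x) i = let j , t = remQuot r x in part (π (i ↑ˡ M) (n′ ↑ʳ j) t)

    selectedRows = rows rowColour
    v      = proj₁ selectedRows
    f      = proj₁ (proj₂ selectedRows)
    f-mono = proj₁ (proj₂ (proj₂ selectedRows))
    p      = proj₂ (proj₂ (proj₂ selectedRows))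

    colColour : Fin (suc r) → Fin M → Fin k
    colColour zero    j = part (b (n′ ↑ʳ j))
    -- On the selected rows the colour at position `t` of column `j` is this entry of `v`, whatever
    -- the row.
    colColour (suc t) j = v (suc (combine j t))

    selectedCols = cols colColour
    v′     = proj₁ selectedCols
    g      = proj₁ (proj₂ selectedCols)
    g-mono = proj₁ (proj₂ (proj₂ selectedCols))
    q      = proj₂ (proj₂ (proj₂ selectedCols))

-- Walks through the cells of a staircase

-- The state (s , p , τ) is the τth of the w steps spent in the cell (s , s) if p = 0 and
-- (s + 1 , s) if p = 1.
State : ℕ → ℕ → Set
State Q w = Fin Q × Fin 2 × Fin w

rank : State Q w → ℕ
rank (s , p , τ) = toℕ (combine (combine s p) τ)

-- One step of the walk, split by where it carries. `turn` stays in column `s`; `return` stays in a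
-- row, and `suc s ≡ inject₁ s′` says that the rows of the two cells coincide.
data Succ {Q w} : Rel (State Q w) 0ℓ where
  advance : ∀ {s p τ τ′} → suc (toℕ τ) ≡ toℕ τ′ → Succ (s , p , τ) (s , p , τ′)
  turn    : ∀ {s τ τ′} → suc (toℕ τ) ≡ w → toℕ τ′ ≡ 0 →
            Succ (s , zero , τ) (s , suc zero , τ′)
  return  : ∀ {s s′ τ τ′} → suc s ≡ inject₁ s′ → suc (toℕ τ) ≡ w → toℕ τ′ ≡ 0 →
            Succ (s , suc zero , τ) (s′ , zero , τ′)

suc≡inject₁⇒ : {s s′ : Fin n} → suc s ≡ inject₁ s′ → suc (toℕ s) ≡ toℕ s′
suc≡inject₁⇒ {s′ = s′} e = trans (cong toℕ e) (Fin.toℕ-inject₁ s′)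

-- Incrementing a two-digit number either increments the low digit or resets it and carries into the
-- high one.
combine-step : (q q′ : Fin n) (τ τ′ : Fin w) → suc (toℕ (combine q τ)) ≡ toℕ (combine q′ τ′) →
               (q ≡ q′ × suc (toℕ τ) ≡ toℕ τ′)
             ⊎ (suc q ≡ inject₁ q′ × suc (toℕ τ) ≡ w × toℕ τ′ ≡ 0)
combine-step {w = w@(suc _)} q q′ τ τ′ e with suc (toℕ τ) ℕ.<? w
... | yes τ⁺<w = inj₁ (proj₁ both , trans (sym (Fin.toℕ-fromℕ< τ⁺<w)) (cong toℕ (proj₂ both)))
  where
  open ≡-Reasoning
  both = Fin.combine-injective q (fromℕ< τ⁺<w) q′ τ′ (Fin.toℕ-injective (begin
    toℕ (combine q (fromℕ< τ⁺<w))       ≡⟨ Fin.toℕ-combine q _ ⟩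
    w * toℕ q + toℕ (fromℕ< τ⁺<w)       ≡⟨ cong (w * toℕ q +_) (Fin.toℕ-fromℕ< τ⁺<w) ⟩
    w * toℕ q + suc (toℕ τ)             ≡⟨ ℕ.+-suc _ _ ⟩
    suc (w * toℕ q + toℕ τ)             ≡⟨ cong suc (Fin.toℕ-combine q τ) ⟨
    suc (toℕ (combine q τ))             ≡⟨ e ⟩
    toℕ (combine q′ τ′)                 ∎))
... | no τ⁺≮w = inj₂ (proj₁ both , last , cong toℕ (sym (proj₂ both)))
  where
  open ≡-Reasoning
  last : suc (toℕ τ) ≡ w
  last = ℕ.≤-antisym (Fin.toℕ<n τ) (ℕ.≮⇒≥ τ⁺≮w)
  -- The incremented high digit may a priori leave `Fin n`, so both numbers are compared with high
  -- digits in `Fin (suc n)`.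
  both = Fin.combine-injective (suc q) zero (inject₁ q′) τ′ (Fin.toℕ-injective (begin
    toℕ (combine (suc q) (zero {n = ℕ.pred w})) ≡⟨ Fin.toℕ-combine (suc q) (zero {n = ℕ.pred w}) ⟩
    w * suc (toℕ q) + 0                 ≡⟨ ℕ.+-identityʳ _ ⟩
    w * suc (toℕ q)                     ≡⟨ ℕ.*-suc w (toℕ q) ⟩
    w + w * toℕ q                       ≡⟨ ℕ.+-comm w _ ⟩
    w * toℕ q + w                       ≡⟨ cong (w * toℕ q +_) last ⟨
    w * toℕ q + suc (toℕ τ)             ≡⟨ ℕ.+-suc _ _ ⟩
    suc (w * toℕ q + toℕ τ)             ≡⟨ cong suc (Fin.toℕ-combine q τ) ⟨
    suc (toℕ (combine q τ))             ≡⟨ e ⟩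
    toℕ (combine q′ τ′)                 ≡⟨ Fin.toℕ-combine q′ τ′ ⟩
    w * toℕ q′ + toℕ τ′                 ≡⟨ cong (λ x → w * x + toℕ τ′) (Fin.toℕ-inject₁ q′) ⟨
    w * toℕ (inject₁ q′) + toℕ τ′       ≡⟨ Fin.toℕ-combine (inject₁ q′) τ′ ⟨
    toℕ (combine (inject₁ q′) τ′)       ∎))

combine-advance : (q : Fin n) (τ τ′ : Fin w) → suc (toℕ τ) ≡ toℕ τ′ →
                  suc (toℕ (combine q τ)) ≡ toℕ (combine q τ′)
combine-advance {w = w} q τ τ′ e = begin
  suc (toℕ (combine q τ))     ≡⟨ cong suc (Fin.toℕ-combine q τ) ⟩
  suc (w * toℕ q + toℕ τ)     ≡⟨ ℕ.+-suc _ _ ⟨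
  w * toℕ q + suc (toℕ τ)     ≡⟨ cong (w * toℕ q +_) e ⟩
  w * toℕ q + toℕ τ′          ≡⟨ Fin.toℕ-combine q τ′ ⟨
  toℕ (combine q τ′)          ∎
  where open ≡-Reasoning

combine-carry : (q q′ : Fin n) (τ τ′ : Fin w) → suc (toℕ q) ≡ toℕ q′ →
                suc (toℕ τ) ≡ w → toℕ τ′ ≡ 0 →
                suc (toℕ (combine q τ)) ≡ toℕ (combine q′ τ′)
combine-carry {w = w} q q′ τ τ′ e last first = begin
  suc (toℕ (combine q τ))     ≡⟨ cong suc (Fin.toℕ-combine q τ) ⟩
  suc (w * toℕ q + toℕ τ)     ≡⟨ ℕ.+-suc _ _ ⟨
  w * toℕ q + suc (toℕ τ)     ≡⟨ cong (w * toℕ q +_) last ⟩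
  w * toℕ q + w               ≡⟨ ℕ.+-comm _ w ⟩
  w + w * toℕ q               ≡⟨ ℕ.*-suc w (toℕ q) ⟨
  w * suc (toℕ q)             ≡⟨ cong (w *_) e ⟩
  w * toℕ q′                  ≡⟨ ℕ.+-identityʳ _ ⟨
  w * toℕ q′ + 0              ≡⟨ cong (w * toℕ q′ +_) first ⟨
  w * toℕ q′ + toℕ τ′         ≡⟨ Fin.toℕ-combine q′ τ′ ⟨
  toℕ (combine q′ τ′)         ∎
  where open ≡-Reasoning

-- Two uses of `combine-step`: a carry out of `τ` increments the number formed by `s` and `p`, which
-- may carry again into `s`.
rank⇒Succ : (x y : State Q w) → suc (rank x) ≡ rank y → Succ x y
rank⇒Succ (s , p , τ) (s′ , p′ , τ′) e with combine-step (combine s p) (combine s′ p′) τ τ′ e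
... | inj₁ (same , τ⁺) with refl , refl ← Fin.combine-injective s p s′ p′ same = advance τ⁺
... | inj₂ (next , last , first) with combine-step s s′ p p′ (suc≡inject₁⇒ next)
rank⇒Succ (s , zero , _) (_ , suc zero , _) _ | inj₂ (_ , last , first) | inj₁ (refl , _) =
  turn last first
rank⇒Succ (s , suc zero , _) (s′ , zero , _) _ | inj₂ (_ , last , first) | inj₂ (s⁺ , _) =
  return s⁺ last first
rank⇒Succ (s , suc zero , _) (_ , suc zero , _) _ | inj₂ (_ , last , first) | inj₁ (_ , ())

Succ⇒rank : {x y : State Q w} → Succ x y → suc (rank x) ≡ rank y
Succ⇒rank (advance {s} {p} τ⁺) = combine-advance (combine s p) _ _ τ⁺
Succ⇒rank (turn {s} last first) =
  combine-carry _ (combine s (suc zero)) _ _ (combine-advance s zero (suc zero) refl) last first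
Succ⇒rank (return {s} {s′} s⁺ last first) =
  combine-carry _ (combine s′ zero) _ _
    (combine-carry s s′ (suc zero) zero (suc≡inject₁⇒ s⁺) refl refl) last first

module _ (0<w : 0 ℕ.< w) where

  private
    R≤R*2*w : R ℕ.≤ R * 2 * w
    R≤R*2*w {R} = ℕ.≤-trans (ℕ.m≤m*n R 2) (ℕ.m≤m*n (R * 2) w ⦃ ℕ.>-nonZero 0<w ⦄)

  -- The digits of `j`. Taking `Q = R` provides `R * 2 * w` states, of which the walk uses the first
  -- `R`.
  stateAt : Fin R → State R w
  stateAt {R} j = let q , τ = remQuot {R * 2} w (inject≤ j R≤R*2*w)
                      s , p = remQuot {R} 2 q
                  in s , p , τ

  rank-stateAt : (j : Fin R) → rank (stateAt j) ≡ toℕ j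
  rank-stateAt {R} j = trans (cong toℕ (trans
      (cong (λ q → combine q τ) (Fin.combine-remQuot {R} 2 q))
      (Fin.combine-remQuot {R * 2} w (inject≤ j R≤R*2*w))))
    (Fin.toℕ-inject≤ j R≤R*2*w)
    where
    q = proj₁ (remQuot {R * 2} w (inject≤ j R≤R*2*w))
    τ = proj₂ (remQuot {R * 2} w (inject≤ j R≤R*2*w))

  module _ (vertex : State R w → Fin m → V) where

    walk : Fin m × Fin R → V
    walk (i , j) = vertex (stateAt j) i

    walk-injective : (∀ {x y i i′} → vertex x i ≡ vertex y i′ → x ≡ y × i ≡ i′) →
                     Injective _≡_ _≡_ walk
    walk-injective inj {i , j} {i′ , j′} e with x≡y , i≡i′ ← inj e =
      cong₂ _,_ i≡i′ (Fin.toℕ-injective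
        (trans (sym (rank-stateAt j)) (trans (cong rank x≡y) (rank-stateAt j′))))

    -- Consecutive layers are exactly those with `Succ`-related states. All other pairs, including a
    -- layer with itself, fall under the second hypothesis.
    walk-pattern : (G : SimpleGraph V) →
      (∀ {x y} → Succ x y → Compared λ i i′ → Adj G (vertex x i) (vertex y i′)) →
      (∀ x y → ¬ Succ x y → ¬ Succ y x →
        Homogeneous λ i i′ → Adj G (vertex x i) (vertex y i′)) →
      IsPattern m R (comap walk G)
    walk-pattern G near far = layers-pattern G (λ j i → vertex (stateAt j) i)
      (λ j → Sum.map₁ (λ full i i′ _ → full i i′) (far _ _ (irreflexive j) (irreflexive j)))
      (λ j j′ d → far _ _ (λ s → ℕ.<⇒≢ d (ranks s))
                          (λ s → ℕ.<-asym (ℕ.<-trans (ℕ.n<1+n _) d) (ℕ.≤-reflexive (ranks s))))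
      (λ j j′ e → near (rank⇒Succ _ _
        (trans (cong suc (rank-stateAt j)) (trans e (sym (rank-stateAt j′))))))
      where
      ranks : ∀ {j j′ : Fin R} → Succ (stateAt j) (stateAt j′) → suc (toℕ j) ≡ toℕ j′
      ranks s = trans (cong suc (sym (rank-stateAt _))) (trans (Succ⇒rank s) (rank-stateAt _))

      irreflexive : ∀ (j : Fin R) → ¬ Succ (stateAt j) (stateAt j)
      irreflexive j = ℕ.1+n≢n ∘ ranks

-- Reversal of path positions

opposite-first : (t : Fin r) → toℕ t ≡ 0 → suc (toℕ (opposite t)) ≡ r
opposite-first zero refl = cong suc (Fin.toℕ-fromℕ _)

opposite-last : (t : Fin r) → suc (toℕ t) ≡ r → toℕ (opposite t) ≡ 0
opposite-last {r} t e = trans (Fin.opposite-prop t)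
  (trans (cong (r ∸_) e) (ℕ.n∸n≡0 r))

opposite-first⁻ : (t : Fin r) → suc (toℕ (opposite t)) ≡ r → toℕ t ≡ 0
opposite-first⁻ t e = subst (λ u → toℕ u ≡ 0) (Fin.opposite-involutive t)
  (opposite-last (opposite t) e)

opposite-last⁻ : (t : Fin r) → toℕ (opposite t) ≡ 0 → suc (toℕ t) ≡ r
opposite-last⁻ t e = subst (λ u → suc (toℕ u) ≡ _) (Fin.opposite-involutive t)
  (opposite-first (opposite t) e)

opposite-step : (t t′ : Fin r) → suc (toℕ t) ≡ toℕ t′ →
                suc (toℕ (opposite t′)) ≡ toℕ (opposite t)
opposite-step {r} t t′ e = begin
  suc (toℕ (opposite t′))    ≡⟨ cong suc (Fin.opposite-prop t′) ⟩
  suc (r ∸ suc (toℕ t′))     ≡⟨ ℕ.+-∸-assoc 1 (Fin.toℕ<n t′) ⟨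
  r ∸ toℕ t′                 ≡⟨ cong (r ∸_) e ⟨
  r ∸ suc (toℕ t)            ≡⟨ Fin.opposite-prop t ⟨
  toℕ (opposite t)           ∎
  where open ≡-Reasoning

opposite-step⁻ : (t t′ : Fin r) → suc (toℕ (opposite t′)) ≡ toℕ (opposite t) →
                 suc (toℕ t) ≡ toℕ t′
opposite-step⁻ t t′ e = subst₂ (λ u u′ → suc (toℕ u) ≡ toℕ u′)
  (Fin.opposite-involutive t) (Fin.opposite-involutive t′)
  (opposite-step (opposite t′) (opposite t) e)

-- Blow-ups

-- What `≡` and `≤` have in common for the blow-up, so that star and half-graph crossings share one
-- argument: attachment is a comparison inside a block and constant between different blocks.
record Blocks {n} (_∼_ : Rel (Fin n) 0ℓ) (q m : ℕ) (f : Fin (q * m) → Fin n) : Set where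
  field
    block     : Fin q → Fin m → Fin n
    block-≡   : ∀ s i → block s i ≡ f (combine s i)
    injective : ∀ {s s′ i i′} → block s i ≡ block s′ i′ → s ≡ s′ × i ≡ i′
    within    : ∃[ c ] ∀ s i i′ → block s i ∼ block s i′ ⇔ ⟦ c ⟧ i i′
    across    : ∀ {s s′} → s ≢ s′ → Homogeneous (λ i i′ → block s i ∼ block s′ i′)

-- Paths are walked from the row root to the column root in cells (s, s), and back in cells (s + 1,
-- s).
direct : Fin 2 → Fin r → Fin r
direct zero       = id
direct (suc zero) = opposite

rowOf : Fin Q → Fin 2 → Fin (suc Q)
rowOf s zero       = inject₁ s
rowOf s (suc zero) = suc s

inject₁≡rowOf⇒zero : ∀ {s : Fin Q} p → inject₁ s ≡ rowOf s p → p ≡ zero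
inject₁≡rowOf⇒zero zero _ = refl
inject₁≡rowOf⇒zero (suc zero) e = contradiction (trans (sym (Fin.toℕ-inject₁ _)) (cong toℕ e)) (≢-sym ℕ.1+n≢n)

rowOf-injective : ∀ {s : Fin Q} p p′ → rowOf s p ≡ rowOf s p′ → p ≡ p′
rowOf-injective zero       p′         e = sym (inject₁≡rowOf⇒zero p′ e)
rowOf-injective (suc zero) zero       e = inject₁≡rowOf⇒zero (suc zero) (sym e)
rowOf-injective (suc zero) (suc zero) e = refl

direct-injective : ∀ p {t t′ : Fin r} → direct p t ≡ direct p t′ → t ≡ t′
direct-injective zero       e = e
direct-injective (suc zero) e =
  trans (sym (Fin.opposite-involutive _)) (trans (cong opposite e) (Fin.opposite-involutive _))

module _ {_∼_ : Rel (Fin n) 0ℓ} where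

  adjᵃ : ∀ {i i′ j} {t : Fin r} → SymClosure (Arc _∼_) (a i) (π i′ j t) ⇔ (i ∼ i′ × toℕ t ≡ 0)
  adjᵃ = mk⇔ (λ { (fwd (rootᵃ p q)) → p , q ; (bwd ()) }) (λ (p , q) → fwd (rootᵃ p q))

  adjᵇ : ∀ {i j j′} {t : Fin r} →
         SymClosure (Arc _∼_) (b j) (π i j′ t) ⇔ (j ∼ j′ × suc (toℕ t) ≡ r)
  adjᵇ = mk⇔ (λ { (fwd (rootᵇ p q)) → p , q ; (bwd ()) }) (λ (p , q) → fwd (rootᵇ p q))

  adjᵖ : ∀ {i j i′ j′} {t t′ : Fin r} → SymClosure (Arc _∼_) (π i j t) (π i′ j′ t′) ⇔
         (i ≡ i′ × j ≡ j′ × (suc (toℕ t) ≡ toℕ t′ ⊎ suc (toℕ t′) ≡ toℕ t))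
  adjᵖ = mk⇔ (λ { (fwd (path e)) → refl , refl , inj₁ e ; (bwd (path e)) → refl , refl , inj₂ e })
             (λ { (refl , refl , inj₁ e) → fwd (path e) ; (refl , refl , inj₂ e) → bwd (path e) })

direct-step : ∀ p {t t′ : Fin r} → suc (toℕ t) ≡ toℕ t′ →
  suc (toℕ (direct p t)) ≡ toℕ (direct p t′) ⊎ suc (toℕ (direct p t′)) ≡ toℕ (direct p t)
direct-step zero       e = inj₁ e
direct-step (suc zero) e = inj₂ (opposite-step _ _ e)

direct-step⁻ : ∀ p {t t′ : Fin r} →
  suc (toℕ (direct p t)) ≡ toℕ (direct p t′) ⊎ suc (toℕ (direct p t′)) ≡ toℕ (direct p t) →
  suc (toℕ t) ≡ toℕ t′ ⊎ suc (toℕ t′) ≡ toℕ t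
direct-step⁻ zero       = id
direct-step⁻ (suc zero) = [ inj₂ ∘ opposite-step⁻ _ _ , inj₁ ∘ opposite-step⁻ _ _ ]

-- Star and half-graph crossings

a-injective : {i i′ : Fin n} → a {n} {r} i ≡ a i′ → i ≡ i′
a-injective refl = refl

b-injective : {i i′ : Fin n} → b {n} {r} i ≡ b i′ → i ≡ i′
b-injective refl = refl

π-injective : {i i′ j j′ : Fin n} {t t′ : Fin r} → π i j t ≡ π i′ j′ t′ → i ≡ i′ × j ≡ j′ × t ≡ t′
π-injective refl = refl , refl , refl

module CrossingWalk {_∼_ : Rel (Fin n) 0ℓ} (_∼?_ : Binary.Decidable _∼_)
                    {row col : Fin (suc Q * m) → Fin n}
                    (rows : Blocks _∼_ (suc Q) m row) (cols : Blocks _∼_ (suc Q) m col) where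

  private
    module X = Blocks rows
    module Y = Blocks cols

  root : Fin 2 → Fin Q → Fin m → CrossingVertex n r
  root zero       s i = a (X.block (inject₁ s) i)
  root (suc zero) s i = b (Y.block (inject₁ s) i)

  -- Step 0 is the root through which the cell is entered, and the other `r` steps run along the
  -- path.
  vertex : State Q (suc r) → Fin m → CrossingVertex n r
  vertex (s , p , zero)  i = root p s i
  vertex (s , p , suc t) i = π (X.block (rowOf s p) i) (Y.block (inject₁ s) i) (direct p t)

  private
    G : SimpleGraph (CrossingVertex n r)
    G = crossing _∼?_

  -- For path vertices the column block gives `s`, then the row block gives `p`, and then the
  -- position gives `t`.
  vertex-injective : {x y : State Q (suc r)} {i i′ : Fin m} →
                     vertex x i ≡ vertex y i′ → x ≡ y × i ≡ i′
  vertex-injective {x = x} {y = y} {i} {i′} = inj x y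
    where
    inj : ∀ x y → vertex {r = r} x i ≡ vertex y i′ → x ≡ y × i ≡ i′
    inj (s , zero , zero) (s′ , zero , zero) e with q , refl ← X.injective (a-injective e)
      with refl ← Fin.inject₁-injective q = refl , refl
    inj (s , suc zero , zero) (s′ , suc zero , zero) e with q , refl ← Y.injective (b-injective e)
      with refl ← Fin.inject₁-injective q = refl , refl
    inj (s , p , suc t) (s′ , p′ , suc t′) e
      with e₁ , e₂ , e₃ ← π-injective e
      with q , refl ← Y.injective e₂
      with refl ← Fin.inject₁-injective q
      with refl ← rowOf-injective p p′ (proj₁ (X.injective e₁))
      with refl ← direct-injective p e₃ = refl , refl
    inj (s , zero , zero) (s′ , suc zero , zero) ()
    inj (s , suc zero , zero) (s′ , zero , zero) ()
    inj (s , zero , zero) (s′ , p , suc t) ()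
    inj (s , suc zero , zero) (s′ , p , suc t) ()
    inj (s , p , suc t) (s′ , zero , zero) ()
    inj (s , p , suc t) (s′ , suc zero , zero) ()

  -- Edges need the path end that faces the root. If that end lies in the block of the root, the
  -- states are consecutive, which is excluded; otherwise `across` makes the adjacency constant.
  root-far : ∀ p (s : Fin Q) p′ s′ (t : Fin r) →
    ¬ Succ (s , p , zero) (s′ , p′ , suc t) → ¬ Succ (s′ , p′ , suc t) (s , p , zero) →
    Homogeneous λ i i′ → Adj G (vertex (s , p , zero) i) (vertex (s′ , p′ , suc t) i′)
  root-far zero s p′ s′ t ¬→ ¬← with toℕ (direct p′ t) ℕ.≟ 0 | inject₁ s Fin.≟ rowOf s′ p′
  ... | no t≢0 | _      = inj₂ λ i i′ → t≢0 ∘ proj₂ ∘ to adjᵃ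
  ... | yes t≡0 | no ≢  = Sum.map (λ full i i′ → from adjᵃ (full i i′ , t≡0))
                                  (λ none i i′ → none i i′ ∘ proj₁ ∘ to adjᵃ) (X.across ≢)
  root-far zero s zero       s′ t ¬→ ¬← | yes t≡0 | yes e with refl ← Fin.inject₁-injective e =
    contradiction (advance (sym (cong suc t≡0))) ¬→
  root-far zero s (suc zero) s′ t ¬→ ¬← | yes t≡0 | yes e =
    contradiction (return (sym e) (cong suc (opposite-last⁻ t t≡0)) refl) ¬←
  root-far (suc zero) s p′ s′ t ¬→ ¬← with suc (toℕ (direct p′ t)) ℕ.≟ _ | s Fin.≟ s′
  ... | no t≢r | _      = inj₂ λ i i′ → t≢r ∘ proj₂ ∘ to adjᵇ
  ... | yes t≡r | no ≢  = Sum.map (λ full i i′ → from adjᵇ (full i i′ , t≡r))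
                                  (λ none i i′ → none i i′ ∘ proj₁ ∘ to adjᵇ)
                                  (Y.across (≢ ∘ Fin.inject₁-injective))
  root-far (suc zero) s zero       s t ¬→ ¬← | yes t≡r | yes refl =
    contradiction (turn (cong suc t≡r) refl) ¬←
  root-far (suc zero) s (suc zero) s t ¬→ ¬← | yes t≡r | yes refl =
    contradiction (advance (sym (cong suc (opposite-first⁻ t t≡r)))) ¬→

  -- Roots are pairwise non-adjacent, and adjacent path vertices lie on a common path, at
  -- consecutive steps of one cell.
  vertex-far : (x y : State Q (suc r)) → ¬ Succ x y → ¬ Succ y x →
               Homogeneous λ i i′ → Adj G (vertex x i) (vertex y i′)
  vertex-far (s , zero     , zero)  (s′ , zero     , zero)   _ _ = inj₂ λ { i i′ (fwd ()) ; i i′ (bwd ()) }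
  vertex-far (s , zero     , zero)  (s′ , suc zero , zero)   _ _ = inj₂ λ { i i′ (fwd ()) ; i i′ (bwd ()) }
  vertex-far (s , suc zero , zero)  (s′ , zero     , zero)   _ _ = inj₂ λ { i i′ (fwd ()) ; i i′ (bwd ()) }
  vertex-far (s , suc zero , zero)  (s′ , suc zero , zero)   _ _ = inj₂ λ { i i′ (fwd ()) ; i i′ (bwd ()) }
  vertex-far (s , p , zero)  (s′ , p′ , suc t) ¬→ ¬← = root-far p s p′ s′ t ¬→ ¬←
  vertex-far (s , p , suc t) (s′ , p′ , zero)  ¬→ ¬← =
    flip-homogeneous G (vertex (s′ , p′ , zero)) (vertex (s , p , suc t)) (root-far p′ s′ p s t ¬← ¬→)
  vertex-far (s , p , suc t) (s′ , p′ , suc t′) ¬→ ¬← = inj₂ nonadjacent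
    where
    nonadjacent : ∀ i i′ → ¬ Adj G (vertex (s , p , suc t) i) (vertex (s′ , p′ , suc t′) i′)
    nonadjacent i i′ e
      with e₁ , e₂ , step ← to adjᵖ e
      with refl ← Fin.inject₁-injective (proj₁ (Y.injective e₂))
      with refl ← rowOf-injective p p′ (proj₁ (X.injective e₁)) =
      [ ¬→ ∘ advance ∘ cong suc , ¬← ∘ advance ∘ cong suc ] (direct-step⁻ p step)

  vertex-near : 1 ℕ.≤ r → {x y : State Q (suc r)} → Succ x y →
                Compared λ i i′ → Adj G (vertex x i) (vertex y i′)
  vertex-near _ (advance {s} {p} {suc t} {suc t′} e) = eq , λ i i′ → mk⇔
    (proj₂ ∘ X.injective ∘ proj₁ ∘ to adjᵖ)
    (λ { refl → from adjᵖ (refl , refl , direct-step p (ℕ.suc-injective e)) })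
  vertex-near _ (advance {s} {zero} {zero} {suc t′} e) =
    proj₁ X.within , λ i i′ → proj₂ X.within _ i i′ ⇔-∘ mk⇔
      (proj₁ ∘ to adjᵃ) (λ q → from adjᵃ (q , sym (ℕ.suc-injective e)))
  vertex-near _ (advance {s} {suc zero} {zero} {suc t′} e) =
    proj₁ Y.within , λ i i′ → proj₂ Y.within _ i i′ ⇔-∘ mk⇔
      (proj₁ ∘ to adjᵇ) (λ q → from adjᵇ (q , opposite-first _ (sym (ℕ.suc-injective e))))
  -- Only an empty path would lead from one root directly to the next.
  vertex-near 1≤r (turn {s} {zero}  {zero} e _) = contradiction (ℕ.suc-injective e) (ℕ.<⇒≢ 1≤r)
  vertex-near 1≤r (turn {s} {suc t} {zero} e _) =
    flip-compared G (vertex (s , suc zero , zero)) (vertex (s , zero , suc t))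
      (proj₁ Y.within , λ i i′ → proj₂ Y.within _ i i′ ⇔-∘ mk⇔
        (proj₁ ∘ to adjᵇ) (λ q → from adjᵇ (q , ℕ.suc-injective e)))
  vertex-near 1≤r (return {s} {s′} {zero}  {zero} _ e _) = contradiction (ℕ.suc-injective e) (ℕ.<⇒≢ 1≤r)
  vertex-near 1≤r (return {s} {s′} {suc t} {zero} s⁺ e _) =
    flip-compared G (vertex (s′ , zero , zero)) (vertex (s , suc zero , suc t))
      (proj₁ X.within , λ i i′ → proj₂ X.within _ i i′ ⇔-∘ mk⇔
        -- The root has row block `inject₁ s′` and the path has `suc s`; `s⁺` identifies the two.
        (subst (λ u → X.block (inject₁ s′) i ∼ X.block u i′) s⁺ ∘ proj₁ ∘ to adjᵃ)
        (λ q → from adjᵃ (subst (λ u → X.block (inject₁ s′) i ∼ X.block u i′) (sym s⁺) q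
                         , opposite-last t (ℕ.suc-injective e))))

-- Clique crossings

adjᶜ : ∀ {i j i′ j′} {t t′ : Fin r} →
  Adj (cliqueCrossing r n) (π i j t) (π i′ j′ t′) ⇔
    ( (i ≡ i′ × j ≡ j′ × (suc (toℕ t) ≡ toℕ t′ ⊎ suc (toℕ t′) ≡ toℕ t))
    ⊎ (π {n} i j t ≢ π i′ j′ t′ ×
        ( (i ≡ i′ × toℕ t ≡ 0 × toℕ t′ ≡ 0)
        ⊎ (j ≡ j′ × suc (toℕ t) ≡ r × suc (toℕ t′) ≡ r))))
adjᶜ = mk⇔
  (Sum.map (to adjᵖ) λ where
    (≢ , inj₁ (_ , p , q)) → let e , t = to adjᵃ p ; e′ , t′ = to adjᵃ q
                             in ≢ , inj₁ (trans (sym e) e′ , t , t′)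
    (≢ , inj₂ (_ , p , q)) → let e , t = to adjᵇ p ; e′ , t′ = to adjᵇ q
                             in ≢ , inj₂ (trans (sym e) e′ , t , t′))
  (Sum.map (from adjᵖ) λ where
    (≢ , inj₁ (e , t , t′)) → ≢ , inj₁ (_ , from adjᵃ (refl , t) , from adjᵃ (e , t′))
    (≢ , inj₂ (e , t , t′)) → ≢ , inj₂ (_ , from adjᵇ (refl , t) , from adjᵇ (e , t′)))

module CliqueWalk {row col : Fin (suc Q * m) → Fin n}
                  (rows : Blocks _≡_ (suc Q) m row) (cols : Blocks _≡_ (suc Q) m col) where

  private
    module X = Blocks rows
    module Y = Blocks cols

    G : SimpleGraph (CrossingVertex n r)
    G = cliqueCrossing _ n

  vertex : State Q r → Fin m → CrossingVertex n r
  vertex (s , p , t) i = π (X.block (rowOf s p) i) (Y.block (inject₁ s) i) (direct p t)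

  vertex-injective : {x y : State Q r} {i i′ : Fin m} →
                     vertex x i ≡ vertex y i′ → x ≡ y × i ≡ i′
  vertex-injective {x = s , p , t} {s′ , p′ , t′} e
    with e₁ , e₂ , e₃ ← π-injective e
    with q , refl ← Y.injective e₂
    with refl ← Fin.inject₁-injective q
    with refl ← rowOf-injective p p′ (proj₁ (X.injective e₁))
    with refl ← direct-injective p e₃ = refl , refl

  -- A row meets at most two cells of the staircase, (s + 1, s) and (s + 1, s + 1), and `return`
  -- joins their ends at the row root.
  common-row : ∀ (s : Fin Q) p (t : Fin r) s′ p′ t′ → rowOf s p ≡ rowOf s′ p′ →
    toℕ (direct p t) ≡ 0 → toℕ (direct p′ t′) ≡ 0 →
    (s , p , t) ≡ (s′ , p′ , t′)
    ⊎ Succ (s , p , t) (s′ , p′ , t′) ⊎ Succ (s′ , p′ , t′) (s , p , t)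
  common-row s zero t s′ zero t′ e z z′
    with refl ← Fin.inject₁-injective e
    with refl ← Fin.toℕ-injective (trans z (sym z′)) = inj₁ refl
  common-row s zero t s′ (suc zero) t′ e z z′ =
    inj₂ (inj₂ (return (sym e) (opposite-last⁻ t′ z′) z))
  common-row s (suc zero) t s′ zero t′ e z z′ =
    inj₂ (inj₁ (return e (opposite-last⁻ t z) z′))
  common-row s (suc zero) t s (suc zero) t′ refl z z′
    with refl ← direct-injective (suc zero) {t} {t′} (Fin.toℕ-injective (trans z (sym z′))) = inj₁ refl

  -- A column meets only the cells (s, s) and (s + 1, s), whose ends at the column root are joined
  -- by `turn`.
  common-col : ∀ (s : Fin Q) p (t : Fin r) p′ t′ →
    suc (toℕ (direct p t)) ≡ r → suc (toℕ (direct p′ t′)) ≡ r →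
    (s , p , t) ≡ (s , p′ , t′)
    ⊎ Succ (s , p , t) (s , p′ , t′) ⊎ Succ (s , p′ , t′) (s , p , t)
  common-col s zero t zero t′ z z′
    with refl ← Fin.toℕ-injective (ℕ.suc-injective (trans z (sym z′))) = inj₁ refl
  common-col s zero t (suc zero) t′ z z′ = inj₂ (inj₁ (turn z (opposite-first⁻ t′ z′)))
  common-col s (suc zero) t zero t′ z z′ = inj₂ (inj₂ (turn z′ (opposite-first⁻ t z)))
  common-col s (suc zero) t (suc zero) t′ z z′
    with refl ← direct-injective (suc zero) {t} {t′}
                  (Fin.toℕ-injective (ℕ.suc-injective (trans z (sym z′)))) = inj₁ refl

  -- Every edge between path vertices shares a row or a column, and that index determines the
  -- position inside its block, hence `i ≡ i′`.
  adjacent⇒Succ : (x y : State Q r) {i i′ : Fin m} → Adj G (vertex x i) (vertex y i′) →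
                  i ≡ i′ × (Succ x y ⊎ Succ y x)
  adjacent⇒Succ x@(s , p , t) y@(s′ , p′ , t′) adj with to adjᶜ adj
  ... | inj₁ (e₁ , e₂ , step)
      with q , refl ← Y.injective e₂
      with refl ← Fin.inject₁-injective q
      with refl ← rowOf-injective p p′ (proj₁ (X.injective e₁))
      = refl , Sum.map advance advance (direct-step⁻ p step)
  ... | inj₂ (≢ , inj₁ (e , z , z′)) with q , refl ← X.injective e =
        refl , [ (λ { refl → contradiction refl ≢ }) , id ] (common-row s p t s′ p′ t′ q z z′)
  ... | inj₂ (≢ , inj₂ (e , z , z′)) with q , refl ← Y.injective e
      with refl ← Fin.inject₁-injective q =
        refl , [ (λ { refl → contradiction refl ≢ }) , id ] (common-col s p t p′ t′ z z′)

  Succ⇒adjacent : {x y : State Q r} → Succ x y → ∀ i → Adj G (vertex x i) (vertex y i)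
  Succ⇒adjacent {x = x} {y} succ i = edge succ
    where
    -- Clique edges require distinct ends; equal vertices would have equal states, whose ranks are
    -- not consecutive.
    x≢y : vertex x i ≢ vertex y i
    x≢y e = ℕ.1+n≢n (trans (Succ⇒rank succ) (cong rank (sym (proj₁ (vertex-injective e)))))

    edge : Succ x y → Adj G (vertex x i) (vertex y i)
    edge (advance {p = p} e)    = from adjᶜ (inj₁ (refl , refl , direct-step p e))
    edge (turn last first)      = from adjᶜ (inj₂ (x≢y , inj₂ (refl , last , opposite-first _ first)))
    edge (return s⁺ last first) = from adjᶜ (inj₂ (x≢y , inj₁ (cong (λ u → X.block u i) s⁺ ,
                                                      opposite-last _ last , first)))

  vertex-near : {x y : State Q r} → Succ x y →
                Compared λ i i′ → Adj G (vertex x i) (vertex y i′)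
  vertex-near {x = x} {y} succ = eq , λ i i′ →
    mk⇔ (proj₁ ∘ adjacent⇒Succ x y) (λ { refl → Succ⇒adjacent succ i })

  vertex-far : (x y : State Q r) → ¬ Succ x y → ¬ Succ y x →
               Homogeneous λ i i′ → Adj G (vertex x i) (vertex y i′)
  vertex-far x y ¬→ ¬← = inj₂ λ i i′ → [ ¬→ , ¬← ] ∘ proj₂ ∘ adjacent⇒Succ x y

-- Blocks of strictly increasing maps

combine-monoʳ-≤ : (s : Fin Q) {i i′ : Fin m} → combine s i Fin.≤ combine s i′ ⇔ i Fin.≤ i′
combine-monoʳ-≤ {m = m} s {i} {i′} rewrite Fin.toℕ-combine s i | Fin.toℕ-combine s i′ =
  mk⇔ (ℕ.+-cancelˡ-≤ (m * toℕ s) _ _) (ℕ.+-monoʳ-≤ (m * toℕ s))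

module _ {f : Fin m → Fin n} (f-mono : StrictlyMonotone f) where

  strictlyMonotone⇒≤⇔ : ∀ {i j} → f i Fin.≤ f j ⇔ i Fin.≤ j
  strictlyMonotone⇒≤⇔ {i} {j} = mk⇔ (λ fi≤fj → ℕ.≮⇒≥ λ j<i → ℕ.<⇒≱ (f-mono j<i) fi≤fj) mono
    where
    mono : i Fin.≤ j → f i Fin.≤ f j
    mono i≤j with ℕ.m≤n⇒m<n∨m≡n i≤j
    ... | inj₁ i<j = ℕ.<⇒≤ (f-mono i<j)
    ... | inj₂ i≡j = ℕ.≤-reflexive (cong (toℕ ∘ f) (Fin.toℕ-injective i≡j))

  strictlyMonotone⇒injective : Injective _≡_ _≡_ f
  strictlyMonotone⇒injective e = Fin.toℕ-injective (ℕ.≤-antisym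
    (to strictlyMonotone⇒≤⇔ (ℕ.≤-reflexive (cong toℕ e)))
    (to strictlyMonotone⇒≤⇔ (ℕ.≤-reflexive (cong toℕ (sym e)))))

module _ {q} {f : Fin (q * m) → Fin n} (f-mono : StrictlyMonotone f) where

  block-injective : ∀ {s s′ : Fin q} {i i′ : Fin m} → f (combine s i) ≡ f (combine s′ i′) → s ≡ s′ × i ≡ i′
  block-injective e =
    Fin.combine-injective _ _ _ _ (strictlyMonotone⇒injective f-mono e)

  blocks-≡ : Blocks _≡_ q m f
  blocks-≡ = record
    { block     = λ s i → f (combine s i)
    ; block-≡   = λ _ _ → refl
    ; injective = block-injective
    ; within    = eq , λ s i i′ → mk⇔ (proj₂ ∘ block-injective) (cong (f ∘ combine s))
    ; across    = λ s≢s′ → inj₂ λ i i′ → s≢s′ ∘ proj₁ ∘ block-injective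
    }

  -- All indices of an earlier block lie below those of a later one, and inside a block the order is
  -- that of the positions.
  blocks-≤ : Blocks Fin._≤_ q m f
  blocks-≤ = record
    { block     = λ s i → f (combine s i)
    ; block-≡   = λ _ _ → refl
    ; injective = block-injective
    ; within    = le , λ s i i′ → combine-monoʳ-≤ s ⇔-∘ strictlyMonotone⇒≤⇔ f-mono
    ; across    = λ {s} {s′} s≢s′ → across s≢s′
    }
    where
    across : ∀ {s s′} → s ≢ s′ → Homogeneous (λ i i′ → f (combine s i) Fin.≤ f (combine s′ i′))
    across {s} {s′} s≢s′ with Fin.<-cmp s s′
    ... | tri< s<s′ _ _ = inj₁ λ i i′ → ℕ.<⇒≤ (f-mono (Fin.combine-monoˡ-< i i′ s<s′))
    ... | tri≈ _ s≡s′ _ = contradiction s≡s′ s≢s′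
    ... | tri> _ _ s>s′ = inj₂ λ i i′ → ℕ.<⇒≱ (f-mono (Fin.combine-monoˡ-< i′ i s>s′))

-- Comparability grids

gridAdj-transpose : {x y x′ y′ : Fin n} →
                    GridAdj n (x , y) (x′ , y′) → GridAdj n (y , x) (y′ , x′)
gridAdj-transpose (≢ , e) = (λ { refl → ≢ refl }) , transposed e
  where
  transposed : _ ⊎ _ ⊎ _ → _
  transposed (inj₁ p)        = inj₂ (inj₁ p)
  transposed (inj₂ (inj₁ p)) = inj₁ p
  transposed (inj₂ (inj₂ f)) = inj₂ (inj₂ (⇔-sym f))

-- For `x < x′` the first alternative is impossible, and the other two amount to `y ≡ y′` and
-- `y < y′`.
gridAdj-≤ : {x y x′ y′ : Fin n} → x Fin.< x′ → GridAdj n (x , y) (x′ , y′) ⇔ y Fin.≤ y′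
gridAdj-≤ x<x′ = mk⇔
  (λ where
    (_ , inj₁ refl)         → contradiction x<x′ (ℕ.n≮n _)
    (_ , inj₂ (inj₁ refl))  → ℕ.≤-refl
    (_ , inj₂ (inj₂ f))     → ℕ.<⇒≤ (to f x<x′))
  (λ y≤y′ → (λ { refl → ℕ.n≮n _ x<x′ }) , inj₂ (Sum.swap (Sum.map
    (λ y<y′ → mk⇔ (λ _ → y<y′) (λ _ → x<x′)) Fin.toℕ-injective (ℕ.m≤n⇒m<n∨m≡n y≤y′))))

⌈n/2⌉≡ : ∀ n → ⌈ n /2⌉ ≡ ⌊ n /2⌋ ⊎ ⌈ n /2⌉ ≡ suc ⌊ n /2⌋
⌈n/2⌉≡ zero          = inj₁ refl
⌈n/2⌉≡ (suc zero)    = inj₂ refl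
⌈n/2⌉≡ (suc (suc n)) = Sum.map (cong suc) (cong suc) (⌈n/2⌉≡ n)

module _ (m R : ℕ) where

  private
    G = comparabilityGrid (R * m)

    -- The coordinates of the staircase cells (0, 0), (1, 0), (1, 1), (2, 1), ...
    ceil floor : Fin R → Fin R
    ceil  j = fromℕ< (ℕ.≤-<-trans (ℕ.⌈n/2⌉≤n (toℕ j)) (Fin.toℕ<n j))
    floor j = fromℕ< (ℕ.≤-<-trans (ℕ.⌊n/2⌋≤n (toℕ j)) (Fin.toℕ<n j))

    toℕ-ceil : ∀ j → toℕ (ceil j) ≡ ⌈ toℕ j /2⌉
    toℕ-ceil j = Fin.toℕ-fromℕ< _
    toℕ-floor : ∀ j → toℕ (floor j) ≡ ⌊ toℕ j /2⌋
    toℕ-floor j = Fin.toℕ-fromℕ< _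

  staircase : Fin R → Fin m → Fin (R * m) × Fin (R * m)
  staircase j i = combine (ceil j) i , combine (floor j) i

  staircase-layer : ∀ j i i′ → i ≢ i′ → Adj G (staircase j i) (staircase j i′)
  staircase-layer j i i′ i≢i′ = (i≢i′ ∘ Fin.combine-injectiveʳ (ceil j) i (ceil j) i′ ∘ cong proj₁)
    , inj₂ (inj₂ (mk⇔ (shift (ceil j) (floor j)) (shift (floor j) (ceil j))))
    where
    shift : (s s′ : Fin R) → combine s i Fin.< combine s i′ → combine s′ i Fin.< combine s′ i′
    shift s s′ i<i′ = ℕ.≰⇒> λ i′≤i → ℕ.<⇒≱ i<i′ (from (combine-monoʳ-≤ s) (to (combine-monoʳ-≤ s′) i′≤i))

  -- Two steps or more along the staircase raise both coordinates of the cell, so the later cell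
  -- dominates the earlier one entirely.
  staircase-far : ∀ j j′ → suc (toℕ j) ℕ.< toℕ j′ → ∀ i i′ →
                  Adj G (staircase j i) (staircase j′ i′)
  staircase-far j j′ d i i′ = from (gridAdj-≤ (Fin.combine-monoˡ-< i i′ ceil<))
                                   (ℕ.<⇒≤ (Fin.combine-monoˡ-< i i′ floor<))
    where
    ceil< : ceil j Fin.< ceil j′
    ceil< = subst₂ ℕ._<_ (sym (toℕ-ceil j)) (sym (toℕ-ceil j′)) (ℕ.⌈n/2⌉-mono d)
    floor< : floor j Fin.< floor j′
    floor< = subst₂ ℕ._<_ (sym (toℕ-floor j)) (sym (toℕ-floor j′)) (ℕ.⌊n/2⌋-mono d)

  -- One step raises a single coordinate, the first for even `j` and the second for odd `j`. The
  -- other stays in its block, where `gridAdj-≤`, transposed for odd `j`, compares the positions.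
  staircase-near : ∀ j j′ → suc (toℕ j) ≡ toℕ j′ →
                   Compared λ i i′ → Adj G (staircase j i) (staircase j′ i′)
  staircase-near j j′ e = le , compare (⌈n/2⌉≡ (toℕ j))
    where
    ceil′ : toℕ (ceil j′) ≡ suc ⌊ toℕ j /2⌋
    ceil′ = trans (toℕ-ceil j′) (cong ⌈_/2⌉ (sym e))
    floor′ : toℕ (floor j′) ≡ ⌈ toℕ j /2⌉
    floor′ = trans (toℕ-floor j′) (cong ⌊_/2⌋ (sym e))

    compare : ⌈ toℕ j /2⌉ ≡ ⌊ toℕ j /2⌋ ⊎ ⌈ toℕ j /2⌉ ≡ suc ⌊ toℕ j /2⌋ →
              ∀ i i′ → Adj G (staircase j i) (staircase j′ i′) ⇔ i Fin.≤ i′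
    compare (inj₁ even) i i′ =
      subst (λ s → combine (floor j) i Fin.≤ combine s i′ ⇔ i Fin.≤ i′) floor≡ (combine-monoʳ-≤ (floor j))
      ⇔-∘ gridAdj-≤ (Fin.combine-monoˡ-< i i′ ceil<)
      where
      floor≡ : floor j ≡ floor j′
      floor≡ = Fin.toℕ-injective (trans (toℕ-floor j) (trans (sym even) (sym floor′)))
      ceil< : ceil j Fin.< ceil j′
      ceil< = ℕ.≤-reflexive (trans (cong suc (trans (toℕ-ceil j) even)) (sym ceil′))
    compare (inj₂ odd) i i′ =
      subst (λ s → combine (ceil j) i Fin.≤ combine s i′ ⇔ i Fin.≤ i′) ceil≡ (combine-monoʳ-≤ (ceil j))
      ⇔-∘ (gridAdj-≤ (Fin.combine-monoˡ-< i i′ floor<) ⇔-∘ mk⇔ gridAdj-transpose gridAdj-transpose)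
      where
      ceil≡ : ceil j ≡ ceil j′
      ceil≡ = Fin.toℕ-injective (trans (toℕ-ceil j) (trans odd (sym ceil′)))
      floor< : floor j Fin.< floor j′
      floor< = ℕ.≤-reflexive (trans (cong suc (toℕ-floor j)) (trans (sym odd) (sym floor′)))

  -- The two coordinates of a cell sum to its number in the staircase.
  staircase-injective : Injective _≡_ _≡_ (λ ((i , j) : Fin m × Fin R) → staircase j i)
  staircase-injective {i , j} {i′ , j′} e
    with ceil≡ , refl ← Fin.combine-injective (ceil j) i (ceil j′) i′ (cong proj₁ e)
    with floor≡ ← Fin.combine-injectiveˡ (floor j) i (floor j′) i′ (cong proj₂ e) =
    cong (i ,_) (Fin.toℕ-injective (begin
      toℕ j                          ≡⟨ ℕ.⌊n/2⌋+⌈n/2⌉≡n (toℕ j) ⟨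
      ⌊ toℕ j /2⌋ + ⌈ toℕ j /2⌉      ≡⟨ cong₂ _+_ (toℕ-floor j) (toℕ-ceil j) ⟨
      toℕ (floor j) + toℕ (ceil j)   ≡⟨ cong₂ (λ s s′ → toℕ s + toℕ s′) floor≡ ceil≡ ⟩
      toℕ (floor j′) + toℕ (ceil j′) ≡⟨ cong₂ _+_ (toℕ-floor j′) (toℕ-ceil j′) ⟩
      ⌊ toℕ j′ /2⌋ + ⌈ toℕ j′ /2⌉    ≡⟨ ℕ.⌊n/2⌋+⌈n/2⌉≡n (toℕ j′) ⟩
      toℕ j′                         ∎))
    where open ≡-Reasoning

  grid-pattern : HasPattern m R G
  grid-pattern = _ , layers-pattern G staircase (λ j → inj₁ (staircase-layer j))
                       (λ j j′ d → inj₁ (staircase-far j j′ d)) staircase-near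
                   , comap-⊑ staircase-injective

-- Patterns in flipped crossings and the conclusion

flipped-walk : 1 ℕ.≤ w → {G H : SimpleGraph V} (flipped : IsFlip k G H)
  (vertex : State R w → Fin m → V) →
  (∀ {x y i i′} → vertex x i ≡ vertex y i′ → x ≡ y × i ≡ i′) →
  (∀ {x y} → Succ x y → Compared λ i i′ → Adj G (vertex x i) (vertex y i′)) →
  (∀ x y → ¬ Succ x y → ¬ Succ y x → Homogeneous λ i i′ → Adj G (vertex x i) (vertex y i′)) →
  (colour : State R w → Fin k) → (∀ x i → IsFlip.part flipped (vertex x i) ≡ colour x) →
  HasPattern m R H
flipped-walk 1≤w {G} flipped vertex inj near far colour coloured =
  _ , flip-pattern flipped (walk 1≤w vertex) walk-inj (colour ∘ stateAt 1≤w)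
        (λ i j → coloured (stateAt 1≤w j) i) (walk-pattern 1≤w vertex G near far)
    , comap-⊑ walk-inj
  where walk-inj = walk-injective 1≤w vertex inj

crossing-flip-pattern : {_∼_ : ∀ {n} → Rel (Fin n) 0ℓ} (_∼?_ : ∀ {n} → Binary.Decidable (_∼_ {n})) →
  (∀ {n q m} {f : Fin (q * m) → Fin n} → StrictlyMonotone f → Blocks _∼_ q m f) →
  ∀ k r m R → 1 ℕ.≤ r → ∃[ n ] ∀ {H} → IsFlip k (crossing {n} {r} _∼?_) H → HasPattern m R H
crossing-flip-pattern {_∼_} _∼?_ blocks k r m R 1≤r
  -- `R` values of `s` require `suc R` row blocks, since the rows reach s + 1; each block has `m`
  -- indices.
  with n , subcrossing ← homogeneous-subcrossing k r (suc R * m) = n , pattern-in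
  where
  pattern-in : ∀ {H} → IsFlip k (crossing {n} {r} _∼?_) H → HasPattern m R H
  pattern-in flipped = flipped-walk (s≤s z≤n) flipped W.vertex W.vertex-injective
    (W.vertex-near 1≤r) W.vertex-far colour coloured
    where
    open HomogeneousSubcrossing (subcrossing (IsFlip.part flipped))
    rows : Blocks _∼_ (suc R) m row
    rows = blocks row-mono
    cols : Blocks _∼_ (suc R) m col
    cols = blocks col-mono
    module X = Blocks rows
    module Y = Blocks cols
    module W = CrossingWalk _∼?_ rows cols

    colour : State R (suc r) → Fin k
    colour (s , p , suc t) = colourᵖ (direct p t)
    colour (s , zero     , zero)  = colourᵃ
    colour (s , suc zero , zero)  = colourᵇ

    coloured : ∀ x i → IsFlip.part flipped (W.vertex x i) ≡ colour x
    coloured (s , zero     , zero)  i rewrite X.block-≡ (inject₁ s) i = colouredᵃ _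
    coloured (s , suc zero , zero)  i rewrite Y.block-≡ (inject₁ s) i = colouredᵇ _
    coloured (s , p        , suc t) i
      rewrite X.block-≡ (rowOf s p) i | Y.block-≡ (inject₁ s) i = colouredᵖ _ _ _

clique-flip-pattern : ∀ k r m R → 1 ℕ.≤ r →
  ∃[ n ] ∀ {H} → IsFlip k (cliqueCrossing r n) H → HasPattern m R H
clique-flip-pattern k r m R 1≤r
  with n , subcrossing ← homogeneous-subcrossing k r (suc R * m) = n , pattern-in
  where
  pattern-in : ∀ {H} → IsFlip k (cliqueCrossing r n) H → HasPattern m R H
  pattern-in flipped = flipped-walk 1≤r flipped W.vertex W.vertex-injective
    W.vertex-near W.vertex-far colour coloured
    where
    open HomogeneousSubcrossing (subcrossing (IsFlip.part flipped))
    rows : Blocks _≡_ (suc R) m row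
    rows = blocks-≡ row-mono
    cols : Blocks _≡_ (suc R) m col
    cols = blocks-≡ col-mono
    module X = Blocks rows
    module Y = Blocks cols
    module W = CliqueWalk rows cols

    colour : State R r → Fin k
    colour (s , p , t) = colourᵖ (direct p t)

    coloured : ∀ x i → IsFlip.part flipped (W.vertex x i) ≡ colour x
    coloured (s , p , t) i
      rewrite X.block-≡ (rowOf s p) i | Y.block-≡ (inject₁ s) i = colouredᵖ _ _ _

theorem4p1 : ∀ {ℓ : Level} (𝒞 : GraphClass ℓ) → PatternFree 𝒞 → MonadicallyDependent 𝒞
theorem4p1 𝒞 (m , R , free) (r , k , 1≤r , large) = excluded large
  where
  pattern-free : ∀ {V} {H : SimpleGraph V} → Contains 𝒞 H → ¬ HasPattern m R H
  pattern-free (G , G∈𝒞 , H⊑G) (P , P-pattern , P⊑H) = free G G∈𝒞 P P-pattern (⊑-trans P⊑H H⊑G)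

  unflippable : (G : ∀ n → SimpleGraph (CrossingVertex n r)) →
    (∃[ n ] ∀ {H} → IsFlip k (G n) H → HasPattern m R H) → ¬ (∀ n → ContainsFlip 𝒞 k (G n))
  -- The one order `n` supplied by the pigeonhole principle already gives a contradiction.
  unflippable G (n , has-pattern) contains with H , flipped , H∈𝒞 ← contains n =
    pattern-free H∈𝒞 (has-pattern flipped)

  excluded : ¬ _
  excluded (inj₁ stars) =
    unflippable (starCrossing r) (crossing-flip-pattern Fin._≟_ blocks-≡ k r m R 1≤r) stars
  excluded (inj₂ (inj₁ cliques)) =
    unflippable (cliqueCrossing r) (clique-flip-pattern k r m R 1≤r) cliques
  excluded (inj₂ (inj₂ (inj₁ half-graphs))) =
    unflippable (halfGraphCrossing r) (crossing-flip-pattern Fin._≤?_ blocks-≤ k r m R 1≤r) half-graphs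
  excluded (inj₂ (inj₂ (inj₂ grids))) = pattern-free (grids (R * m)) (grid-pattern m R)
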